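{- Let $\mathcal{G}=(V,E,\lambda)$ be a happy compressed temporal graph and let $e,e'\in E$ be two distinct edges. If $\lambda(e)$ is unique (that is, $\lambda(f)\neq\lambda(e)$ for every edge $f\in E$ with $f\ne e$) and $\lambda(e)<\lambda(e')$, then $e\leadsto e'$.
   Context: A happy temporal graph is a triple $\mathcal{G}=(V,E,\lambda)$ where $(V,E)$ is a finite simple undirected graph (the footprint) and $\lambda:E\to\{1,2,3,\dots\}$ assigns a single time label to each edge, such that two distinct edges sharing an endpoint have different labels. It is compressed if for every edge $e$ with $\lambda(e)>1$ there is an edge $e'$ adjacent to $e$ with $\lambda(e')=\lambda(e)-1$. A temporal walk is a walk in the footprint along which edge labels are strictly increasing. For edges $e,e'$, $e\leadsto e'$ means that some temporal walk traverses $e$ and $e'$ in this order, not necessarily consecutively (edges may be traversed in either direction). -}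

module Defs where

open import Data.Fin.Base using (Fin; _<_)
open import Data.List.Base using (List; []; _∷_)
open import Data.List.Relation.Binary.Sublist.Propositional using (_⊆_)
open import Data.List.Relation.Unary.Linked using (Linked)
open import Data.Nat.Base as ℕ using (ℕ; _≤_; _∸_)
open import Data.Product.Base using (Σ-syntax; ∃-syntax; _×_)
open import Data.Sum.Base using (_⊎_)
open import Level using (0ℓ)
open import Relation.Binary.Core using (Rel)
open import Relation.Binary.Definitions using (Decidable; Irreflexive; Symmetric)
open import Relation.Binary.PropositionalEquality using (_≡_; _≢_)

record SimpleGraph : Set₁ where
  field
    order : ℕ

  Vertex : Set
  Vertex = Fin order

  field
    Adj        : Rel Vertex 0ℓ
    adj?       : Decidable Adj
    adj-sym    : Symmetric Adj
    adj-irrefl : Irreflexive _≡_ Adj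

  -- An undirected edge {u , v} is represented once, by its endpoints in
  -- increasing order. The proof fields are irrelevant, so two edges are
  -- equal exactly when they have the same endpoints.
  record Edge : Set where
    constructor edge
    field
      lo hi    : Vertex
      .lo<hi   : lo < hi
      .joined  : Adj lo hi

  open Edge public

  Incident : Vertex → Edge → Set
  Incident v e = v ≡ lo e ⊎ v ≡ hi e

  ShareEndpoint : Rel Edge 0ℓ
  ShareEndpoint e f = ∃[ v ] (Incident v e × Incident v f)

  AdjacentEdges : Rel Edge 0ℓ
  AdjacentEdges e f = e ≢ f × ShareEndpoint e f

  -- Traverses e u v: e can be crossed from u to v (in either direction).
  Traverses : Edge → Vertex → Vertex → Set
  Traverses e u v = (u ≡ lo e × v ≡ hi e) ⊎ (u ≡ hi e × v ≡ lo e)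

  data Walk : Vertex → Vertex → Set where
    stop : ∀ {u} → Walk u u
    step : ∀ {u v w} (e : Edge) → Traverses e u v → Walk v w → Walk u w

  walkEdges : ∀ {u v} → Walk u v → List Edge
  walkEdges stop         = []
  walkEdges (step e _ w) = e ∷ walkEdges w

record HappyTemporalGraph : Set₁ where
  field
    footprint : SimpleGraph

  open SimpleGraph footprint public

  field
    label          : Edge → ℕ
    label-positive : ∀ e → 1 ≤ label e
    label-proper   : ∀ e f → e ≢ f → ShareEndpoint e f → label e ≢ label f

  Compressed : Set
  Compressed = ∀ e → 1 ℕ.< label e →
    ∃[ f ] (AdjacentEdges f e × label f ≡ label e ∸ 1)

  Temporal : ∀ {u v} → Walk u v → Set
  Temporal w = Linked (λ e f → label e ℕ.< label f) (walkEdges w)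

  UniqueLabel : Edge → Set
  UniqueLabel e = ∀ f → f ≢ e → label f ≢ label e

  infix 4 _⇝_

  -- The sublist relation (_⊆_) keeps order and multiplicity but need not be
  -- contiguous: e occurs before e′, with other edges possibly in between.
  _⇝_ : Rel Edge 0ℓ
  e ⇝ e′ = ∃[ u ] ∃[ v ] Σ[ w ∈ Walk u v ]
    (Temporal w × (e ∷ e′ ∷ []) ⊆ walkEdges w)

{-# OPTIONS --safe #-}

-- Compressedness lets one descend from e′ through edges with consecutive
-- labels, each sharing an endpoint with the next; uniqueness of label e forces
-- the descent to end in e. Such a chain need not be a walk, because three
-- consecutive edges may meet in one vertex, but then the middle one can be
-- dropped.
module Submission where

open import Defs
open import Data.Fin.Properties using (_≟_)
open import Data.List.Base using (_∷_; [])
open import Data.List.Membership.Propositional using (_∈_)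
open import Data.List.Relation.Binary.Sublist.Propositional using (from∈)
open import Data.List.Relation.Binary.Sublist.Heterogeneous.Core using (_∷_)
open import Data.List.Relation.Unary.Any using (here; there)
open import Data.List.Relation.Unary.Linked using (Linked; [-]; _∷_)
open import Data.Nat.Base using (zero; suc; pred; _+_; _<_; s≤s)
open import Data.Nat.Properties using (<-trans; ≤-trans; ≤-reflexive; m≤n+m; m≤n⇒∃[o]m+o≡n; +-comm)
open import Data.Product.Base using (Σ-syntax; ∃-syntax; _×_; _,_)
open import Data.Sum.Base using (_⊎_; inj₁; inj₂; swap)
open import Relation.Binary.Definitions using (DecidableEquality)
open import Relation.Binary.PropositionalEquality using (_≡_; _≢_; refl; sym; trans; cong; subst)
open import Relation.Nullary.Decidable using (yes; no; decidable-stable)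

module _ (S : SimpleGraph) where
  open SimpleGraph S

  edge-≟ : DecidableEquality Edge
  edge-≟ (edge l h _ _) (edge l′ h′ _ _) with l ≟ l′ | h ≟ h′
  ... | yes refl | yes refl = yes refl
  ... | no l≢l′  | _        = no λ { refl → l≢l′ refl }
  ... | yes _    | no h≢h′  = no λ { refl → h≢h′ refl }

  incident⇒traverses-to : ∀ {v} e → Incident v e → ∃[ u ] Traverses e u v
  incident⇒traverses-to e (inj₁ v≡lo) = hi e , inj₂ (refl , v≡lo)
  incident⇒traverses-to e (inj₂ v≡hi) = lo e , inj₁ (refl , v≡hi)

  incident⇒traverses-from : ∀ {v} e → Incident v e → ∃[ w ] Traverses e v w
  incident⇒traverses-from e (inj₁ v≡lo) = hi e , inj₁ (v≡lo , refl)
  incident⇒traverses-from e (inj₂ v≡hi) = lo e , inj₂ (v≡hi , refl)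

  incident-traversed : ∀ e {u v x} → Traverses e u v → Incident x e → x ≡ u ⊎ x ≡ v
  incident-traversed _ (inj₁ (refl , refl)) x∈e = x∈e
  incident-traversed _ (inj₂ (refl , refl)) x∈e = swap x∈e

module _ (G : HappyTemporalGraph) where
  open HappyTemporalGraph G

  -- Unlike in _⇝_, the walk has to start with e.
  StartsToward : Edge → Edge → Set
  StartsToward e e′ = ∃[ u ] ∃[ x ] ∃[ v ] Σ[ t ∈ Traverses e u x ] Σ[ w ∈ Walk x v ]
    (Temporal (step e t w) × e′ ∈ walkEdges w)

  startsToward⇒⇝ : ∀ {e e′} → StartsToward e e′ → e ⇝ e′
  startsToward⇒⇝ (_ , _ , _ , t , w , temporal , e′∈w) =
    _ , _ , step _ t w , temporal , refl ∷ from∈ e′∈w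

  -- No direction is prescribed for either edge, so `e` can be crossed into the shared vertex and
  -- `f` out of it.
  startsToward-adjacent : ∀ {e f} → ShareEndpoint e f → label e < label f → StartsToward e f
  startsToward-adjacent {e} {f} (_ , x∈e , x∈f) e<f =
    let _ , t  = incident⇒traverses-to footprint e x∈e
        _ , t′ = incident⇒traverses-from footprint f x∈f
    in _ , _ , _ , t , step f t′ stop , e<f ∷ [-] , here refl

  lower-head : ∀ {e f es} → label e < label f →
    Linked (λ a b → label a < label b) (f ∷ es) → Linked (λ a b → label a < label b) (e ∷ es)
  lower-head e<f [-]          = [-]
  lower-head e<f (f<g ∷ rest) = <-trans e<f f<g ∷ rest

  -- The direction of `f` is fixed by the given walk, so what matters is which end of `f` meets `e`.
  -- Since `e′` occurs after `f`, dropping `f` cannot lose it.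
  startsToward-extend : ∀ {e f e′} → ShareEndpoint e f → label e < label f →
    StartsToward f e′ → StartsToward e e′
  startsToward-extend {e} {f} (_ , x∈e , x∈f) e<f (_ , _ , _ , t , w , temporal , e′∈w)
    with incident⇒traverses-to footprint e x∈e | incident-traversed footprint f t x∈f
  ... | _ , s | inj₁ refl = _ , _ , _ , s , step f t w , e<f ∷ temporal , there e′∈w
  -- `e` meets `f` where `w` begins, so `e` leads into `w` directly and replaces `f`.
  ... | _ , s | inj₂ refl = _ , _ , _ , s , w , lower-head e<f temporal , e′∈w

  predecessor : Compressed → ∀ {n} f → 0 < n → label f ≡ suc n →
    ∃[ g ] (ShareEndpoint g f × label g ≡ n × label g < label f)
  predecessor compressed f 0<n f≡1+n
    with compressed f (subst (1 <_) (sym f≡1+n) (s≤s 0<n))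
  ... | g , (_ , g~f) , g≡f∸1 =
    let g≡n = trans g≡f∸1 (cong pred f≡1+n)
    in g , g~f , g≡n , ≤-reflexive (trans (cong suc g≡n) (sym f≡1+n))

  -- Abstracting over how a walk toward e′ is entered through f covers both the
  -- start f = e′, whose direction of traversal is still free, and later edges.
  descend : Compressed → ∀ {e e′} → UniqueLabel e → ∀ n f → label f ≡ suc (n + label e) →
    (∀ {g} → ShareEndpoint g f → label g < label f → StartsToward g e′) → StartsToward e e′
  descend compressed {e} {e′} unique n f f≡ enter
    -- Positivity of `label e` puts `label f` above 1, as compressedness requires.
    with predecessor compressed f (≤-trans (label-positive e) (m≤n+m (label e) n)) f≡
  descend compressed {e} {e′} unique zero f f≡ enter | g , g~f , g≡ , g<f =
    subst (λ h → StartsToward h e′)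
      -- Uniqueness only refutes `g ≢ e`; decidable equality of edges turns this into `g ≡ e`.
      (decidable-stable (edge-≟ footprint g e) λ g≢e → unique g g≢e g≡)
      (enter g~f g<f)
  descend compressed unique (suc n) f f≡ enter | g , g~f , g≡ , g<f =
    descend compressed unique n g g≡
      -- From `g` on, a walk toward `e′` is already fixed, and each lower neighbour `h` extends it.
      λ h~g h<g → startsToward-extend h~g h<g (enter g~f g<f)

lemma3p2 : (G : HappyTemporalGraph) → let open HappyTemporalGraph G in
    Compressed → (e e′ : Edge) → e ≢ e′ →
    UniqueLabel e → label e < label e′ → e ⇝ e′
lemma3p2 G compressed e e′ _ unique e<e′ =
  let open HappyTemporalGraph G
      -- `n` counts the values strictly between the two labels.
      n , 1+e+n≡e′ = m≤n⇒∃[o]m+o≡n e<e′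
      e′≡1+n+e = trans (sym 1+e+n≡e′) (cong suc (+-comm (label e) n))
  in startsToward⇒⇝ G
       (descend G compressed unique n e′ e′≡1+n+e (startsToward-adjacent G))
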